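{- Let $C$ be a binary singly even self-dual $[106,53,18]$ code whose shadow $S$ has minimum weight at least $5$, with weight enumerators of $C$ and $S$ of the form $$\begin{aligned}W_C=&\,1+(35245 + 2 d )y^{18}+(416262 + 128 c - 2 d )y^{20}+(6586310 + 8192 b - 896 c - 34 d )y^{22}\\&+(86626645 + 524288 a - 106496 b + 1024 c + 34 d )y^{24}+ \cdots,\end{aligned}$$ $$W_S=a y^5+(- 24 a - b )y^9+( 276 a + 22 b + c )y^{13}+(- 2024 a - 231 b - 20 c - d )y^{17}+ \cdots,$$ where $a,b,c,d$ are integers and the dots denote terms of higher degree. Then $d$ is an even integer.
   Context: All codes are binary: a code of length $n$ is a subspace of $\mathbb{F}_2^n$, and $[n,k,d]$ denotes length $n$, dimension $k$, minimum weight $d$. A code $C$ is self-dual if $C=C^\perp$ with respect to the standard inner product. A self-dual code is singly even if it contains a codeword of weight $\equiv 2 \pmod 4$. For a singly even self-dual code $C$, let $C_0$ be the subcode of codewords of weight $\equiv 0 \pmod 4$; the shadow of $C$ is $S=C_0^\perp\setminus C$. The weight enumerators are $W_C=\sum_i A_i y^i$ and $W_S=\sum_i B_i y^i$, where $A_i$ and $B_i$ are the numbers of vectors of weight $i$ in $C$ and $S$, respectively. Every singly even self-dual $[106,53,18]$ code with shadow of minimum weight at least $5$ has weight enumerators of the displayed form for some integers $a,b,c,d$. -}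

module Defs where

open import Level using (Level; 0ℓ)
open import Data.Bool.Base using (Bool; true; false; _∧_; _xor_)
import Data.Bool.Properties as Bool
open import Data.Fin.Subset.Properties using (anySubset?)
open import Data.Integer.Base using (ℤ; +_; 0ℤ) renaming (_+_ to _+ℤ_)
open import Data.List.Base using (List; []; _∷_; _++_; map; filter; length)
open import Data.Nat.Base using (ℕ; zero; suc; _≤_; _%_)
open import Data.Nat.Properties using (_≟_)
open import Data.Product.Base using (∃-syntax; _×_; _,_)
open import Data.Vec.Base using (Vec; []; _∷_; zipWith; replicate; foldr′; count)
import Data.Vec.Base as Vec
open import Data.Vec.Relation.Unary.All using (All)
open import Relation.Binary.PropositionalEquality using (_≡_; _≢_)
open import Relation.Nullary.Decidable using (yes; no; ¬?; _×-dec_; map′; decidable-stable)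
open import Relation.Unary using (Pred; Decidable; _∈_; _≐_; _∖_)
open import Relation.Unary.Properties using (_∩?_; ∁?)

private
  variable
    n k : ℕ
    ℓ : Level

-- The field 𝔽₂ is Bool with addition _xor_ and multiplication _∧_
-- (the ring Data.Bool.Properties.xor-∧-commutativeRing).

Word : ℕ → Set
Word n = Vec Bool n

infixl 6 _⊕_
infixr 7 _⊛_ _·_

𝟎 : Word n
𝟎 = replicate _ false

_⊕_ : Word n → Word n → Word n
_⊕_ = zipWith _xor_

_⊛_ : Bool → Word n → Word n
c ⊛ x = Vec.map (c ∧_) x

_·_ : Word n → Word n → Bool
x · y = foldr′ _xor_ false (zipWith _∧_ x y)

wt : Word n → ℕ
wt = count (Bool._≟ true)

-- Subsets of 𝔽₂ⁿ are decidable predicates, so that their elements can be counted.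

record Code (n : ℕ) : Set₁ where
  field
    Codeword  : Pred (Word n) 0ℓ
    codeword? : Decidable Codeword
    𝟎-closed  : 𝟎 ∈ Codeword
    ⊕-closed  : ∀ {x y} → x ∈ Codeword → y ∈ Codeword → x ⊕ y ∈ Codeword
    ⊛-closed  : ∀ c {x} → x ∈ Codeword → c ⊛ x ∈ Codeword

open Code public

linearCombination : Vec Bool k → Vec (Word n) k → Word n
linearCombination cs bs = foldr′ _⊕_ 𝟎 (zipWith _⊛_ cs bs)

record IsBasis (C : Code n) (bs : Vec (Word n) k) : Set where
  field
    members     : All (Codeword C) bs
    spanning    : ∀ x → x ∈ Codeword C → ∃[ cs ] linearCombination cs bs ≡ x
    independent : ∀ cs → linearCombination cs bs ≡ 𝟎 → cs ≡ 𝟎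

HasDimension : Code n → ℕ → Set
HasDimension {n} C k = ∃[ bs ] IsBasis {n} {k} C bs

record HasMinimumWeight (C : Code n) (d : ℕ) : Set where
  field
    attained   : ∃[ x ] x ∈ Codeword C × x ≢ 𝟎 × wt x ≡ d
    lowerBound : ∀ x → x ∈ Codeword C → x ≢ 𝟎 → d ≤ wt x

record Is[_,_,_] (n k d : ℕ) (C : Code n) : Set where
  field
    dimension     : HasDimension C k
    minimumWeight : HasMinimumWeight C d

infix 8 _^⊥

_^⊥ : Pred (Word n) ℓ → Pred (Word n) ℓ
(P ^⊥) x = ∀ y → y ∈ P → x · y ≡ false

^⊥? : {P : Pred (Word n) ℓ} → Decidable P → Decidable (P ^⊥)
^⊥? P? x = map′
  (λ ¬∃ y y∈P → decidable-stable (x · y Bool.≟ false) λ x·y≢0 → ¬∃ (y , y∈P , x·y≢0))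
  (λ x∈P^⊥ (y , y∈P , x·y≢0) → x·y≢0 (x∈P^⊥ y y∈P))
  (¬? (anySubset? λ y → P? y ×-dec ¬? (x · y Bool.≟ false)))

SelfDual : Code n → Set
SelfDual C = Codeword C ≐ Codeword C ^⊥

SinglyEven : Code n → Set
SinglyEven C = ∃[ x ] x ∈ Codeword C × wt x % 4 ≡ 2

DoublyEvenSubcode : Code n → Pred (Word n) 0ℓ
DoublyEvenSubcode C x = x ∈ Codeword C × wt x % 4 ≡ 0

doublyEvenSubcode? : (C : Code n) → Decidable (DoublyEvenSubcode C)
doublyEvenSubcode? C x = codeword? C x ×-dec (wt x % 4 ≟ 0)

Shadow : Code n → Pred (Word n) 0ℓ
Shadow C = DoublyEvenSubcode C ^⊥ ∖ Codeword C

shadow? : (C : Code n) → Decidable (Shadow C)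
shadow? C = ^⊥? (doublyEvenSubcode? C) ∩? ∁? (codeword? C)

allWords : ∀ n → List (Word n)
allWords zero    = [] ∷ []
allWords (suc n) = map (false ∷_) (allWords n) ++ map (true ∷_) (allWords n)

-- The coefficient sequence of the weight enumerator of a subset of 𝔽₂ⁿ.

weightEnumerator : {P : Pred (Word n) ℓ} → Decidable P → ℕ → ℕ
weightEnumerator {n} P? i = length (filter (λ x → P? x ×-dec (wt x ≟ i)) (allWords n))

W[_] : Code n → ℕ → ℕ
W[ C ] = weightEnumerator (codeword? C)

Wₛ[_] : Code n → ℕ → ℕ
Wₛ[ C ] = weightEnumerator (shadow? C)

infix 6 _y^_

_y^_ : ℤ → ℕ → ℤ × ℕ
c y^ i = c , i

coefficient : List (ℤ × ℕ) → ℕ → ℤ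
coefficient []             i = 0ℤ
coefficient ((c , j) ∷ ts) i with j ≟ i
... | yes _ = c +ℤ coefficient ts i
... | no  _ = coefficient ts i

-- The polynomial with coefficients W is the sum of the monomials ts plus
-- terms of degree greater than m. In particular every coefficient of degree
-- at most m that is not listed in ts vanishes.

infix 4 _≈_+higherThan_

_≈_+higherThan_ : (ℕ → ℕ) → List (ℤ × ℕ) → ℕ → Set
W ≈ ts +higherThan m = ∀ i → i ≤ m → + W i ≡ coefficient ts i

{-# OPTIONS --safe #-}

module Submission where

-- Fix s in the shadow S with wt s ≡ 1 (mod 4); if there is none, B₉ = B₁₇ = 0.
-- Then S = s + C, all its weights are ≡ 1 (mod 4), and the function F supported
-- on S with F(s + c) = ± (-1)^(s·c), which takes opposite values on the two
-- cosets of C₀ in S, satisfies F̂ = -|C| F and F(𝟏 + x) = -F(x).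
-- Hence the numbers fᵢ = ∑ F(x) over wt x = i satisfy the MacWilliams identities
-- of an eigenvector of the Krawtchouk matrix. The combination of these that
-- only involves weights at most 17 (or at least 89) reads
--   f₁₇ + 18 f₁₃ + 171 f₉ + 1140 f₅ + 5985 f₁ = 0.
-- Here f₁ = 0, and F ≡ 1 (mod 2) on S, so fᵢ ≡ Bᵢ and B₉ + B₁₇ is even.
-- In terms of a, b, c, d this sum is ≡ d (mod 2).

open import Defs
open import Data.Integer.Base using (ℤ; +_; -_; _+_; _-_; _*_)
open import Data.Integer.Divisibility.Signed using (_∣_)
open import Data.List.Base using ([]; _∷_)
open import Data.Nat.Base using (_≤_)
open import Relation.Unary using (_∈_)
open import Data.Bool.Base using (Bool; true; false; not; if_then_else_; _∧_; _xor_)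
import Data.Bool.Properties as Bool
open import Data.Fin.Subset.Properties using (anySubset?)
open import Data.Integer.Base using (0ℤ; 1ℤ; -1ℤ; ≢-nonZero)
import Data.Integer.Properties as ℤ
open import Data.Integer.Divisibility.Signed using (divides; _∣?_; ∣m∣n⇒∣m+n; ∣m+n∣m⇒∣n; ∣m⇒∣-m)
open import Data.Integer.Tactic.RingSolver using (solve-∀)
open import Data.List.Base using (List; _++_; map; filter; length)
open import Data.List.Properties using (filter-++; length-++)
open import Data.Nat.Base as ℕ using (ℕ; zero; suc; _∸_; _<_; _%_; s≤s)
open import Data.Nat.DivMod using (%-distribˡ-+; [m+kn]%n≡m%n; m%n%n≡m%n; m%n<n)
open import Data.Nat.GeneralisedArithmetic using (iterate)
import Data.Nat.Properties as ℕ
open import Data.Nat.Tactic.RingSolver using () renaming (solve-∀ to ℕ-solve-∀)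
open import Data.Product.Base using (∃-syntax; _×_; _,_; proj₁; proj₂)
open import Data.Sum.Base using (_⊎_; inj₁; inj₂)
open import Data.Vec.Base using ([]; _∷_; replicate)
open import Data.Vec.Properties using (count≤n; zipWith-assoc; zipWith-comm; zipWith-identityʳ)
open import Function.Base using (_∘_; case_of_)
open import Function.Bundles using (_⇔_; mk⇔)
open import Relation.Binary.PropositionalEquality
open import Relation.Nullary using (¬_; Dec; yes; no; does; contradiction)
open import Relation.Nullary.Decidable using (from-yes; from-no; _×-dec_; _→-dec_; does-⇔; dec-true; dec-false)
import Relation.Unary as Unary

open ≡-Reasoning

private
  variable
    n : ℕ

-- Words

𝟏 : Word n
𝟏 = replicate _ true

⊕-assoc : (x y z : Word n) → (x ⊕ y) ⊕ z ≡ x ⊕ (y ⊕ z)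
⊕-assoc = zipWith-assoc Bool.xor-assoc

⊕-comm : (x y : Word n) → x ⊕ y ≡ y ⊕ x
⊕-comm = zipWith-comm Bool.xor-comm

⊕-self : (x : Word n) → x ⊕ x ≡ 𝟎
⊕-self []      = refl
⊕-self (b ∷ x) = cong₂ _∷_ (Bool.xor-same b) (⊕-self x)

⊕-cancelʳ : (x y : Word n) → (x ⊕ y) ⊕ y ≡ x
⊕-cancelʳ x y = begin
  (x ⊕ y) ⊕ y ≡⟨ ⊕-assoc x y y ⟩
  x ⊕ (y ⊕ y) ≡⟨ cong (x ⊕_) (⊕-self y) ⟩
  x ⊕ 𝟎       ≡⟨ zipWith-identityʳ Bool.xor-identityʳ x ⟩
  x           ∎

⊕-swapʳ : (x y z : Word n) → (x ⊕ y) ⊕ z ≡ (x ⊕ z) ⊕ y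
⊕-swapʳ x y z = begin
  (x ⊕ y) ⊕ z ≡⟨ ⊕-assoc x y z ⟩
  x ⊕ (y ⊕ z) ≡⟨ cong (x ⊕_) (⊕-comm y z) ⟩
  x ⊕ (z ⊕ y) ≡⟨ ⊕-assoc x z y ⟨
  (x ⊕ z) ⊕ y ∎

·-comm : (x y : Word n) → x · y ≡ y · x
·-comm []      []      = refl
·-comm (a ∷ x) (b ∷ y) = cong₂ _xor_ (Bool.∧-comm a b) (·-comm x y)

xor-interchange : ∀ a b c d → (a xor b) xor (c xor d) ≡ (a xor c) xor (b xor d)
xor-interchange false b c d = begin
  b xor (c xor d) ≡⟨ Bool.xor-assoc b c d ⟨
  (b xor c) xor d ≡⟨ cong (_xor d) (Bool.xor-comm b c) ⟩
  (c xor b) xor d ≡⟨ Bool.xor-assoc c b d ⟩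
  c xor (b xor d) ∎
xor-interchange true  b c d = begin
  not b xor (c xor d)   ≡⟨ Bool.not-distribˡ-xor b (c xor d) ⟨
  not (b xor (c xor d)) ≡⟨ cong not (xor-interchange false b c d) ⟩
  not (c xor (b xor d)) ≡⟨ Bool.not-distribˡ-xor c (b xor d) ⟩
  not c xor (b xor d)   ∎

·-distribˡ-⊕ : (x y z : Word n) → x · (y ⊕ z) ≡ (x · y) xor (x · z)
·-distribˡ-⊕ []      []      []      = refl
·-distribˡ-⊕ (a ∷ x) (b ∷ y) (c ∷ z) = begin
  (a ∧ (b xor c)) xor (x · (y ⊕ z))
    ≡⟨ cong₂ _xor_ (Bool.∧-distribˡ-xor a b c) (·-distribˡ-⊕ x y z) ⟩
  ((a ∧ b) xor (a ∧ c)) xor ((x · y) xor (x · z))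
    ≡⟨ xor-interchange (a ∧ b) (a ∧ c) (x · y) (x · z) ⟩
  ((a ∧ b) xor (x · y)) xor ((a ∧ c) xor (x · z)) ∎

·-distribʳ-⊕ : (x y z : Word n) → (y ⊕ z) · x ≡ (y · x) xor (z · x)
·-distribʳ-⊕ x y z = begin
  (y ⊕ z) · x         ≡⟨ ·-comm (y ⊕ z) x ⟩
  x · (y ⊕ z)         ≡⟨ ·-distribˡ-⊕ x y z ⟩
  (x · y) xor (x · z) ≡⟨ cong₂ _xor_ (·-comm x y) (·-comm x z) ⟩
  (y · x) xor (z · x) ∎

-- In 𝔽₂ every element is its own square, so both sides are the parity of `wt x`.
·-𝟏 : (x : Word n) → x · 𝟏 ≡ x · x
·-𝟏 []          = refl
·-𝟏 (false ∷ x) = ·-𝟏 x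
·-𝟏 (true ∷ x)  = cong not (·-𝟏 x)

wt≤n : (x : Word n) → wt x ≤ n
wt≤n = count≤n (Bool._≟ true)

wt-𝟎 : ∀ n → wt (𝟎 {n}) ≡ 0
wt-𝟎 zero    = refl
wt-𝟎 (suc n) = wt-𝟎 n

wt-⊕-𝟏 : (x : Word n) → wt (x ⊕ 𝟏) ≡ n ∸ wt x
wt-⊕-𝟏         []          = refl
wt-⊕-𝟏 {suc n} (false ∷ x) = trans (cong suc (wt-⊕-𝟏 x)) (sym (ℕ.+-∸-assoc 1 (wt≤n x)))
wt-⊕-𝟏         (true ∷ x)  = wt-⊕-𝟏 x

-- Weights modulo 4

twice : Bool → ℕ
twice b = if b then 2 else 0

-- If m coordinates are 1 in both words, then wt x + wt y = wt (x ⊕ y) + 2m, and 2m ≡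
-- `twice (x · y)` (mod 4) because `x · y` is the parity of m. As 2 ≡ -2 (mod 4), this term may be
-- added on the left, which avoids subtraction.
wt-⊕ : (x y : Word n) → ∃[ k ] wt x ℕ.+ wt y ℕ.+ twice (x · y) ≡ wt (x ⊕ y) ℕ.+ k ℕ.* 4
wt-⊕ [] [] = 0 , refl
wt-⊕ (false ∷ x) (false ∷ y) = wt-⊕ x y
wt-⊕ (false ∷ x) (true ∷ y)  with k , eq ← wt-⊕ x y =
  k , trans (cong (ℕ._+ twice (x · y)) (ℕ.+-suc (wt x) (wt y))) (cong suc eq)
wt-⊕ (true ∷ x)  (false ∷ y) with k , eq ← wt-⊕ x y = k , cong suc eq
wt-⊕ (true ∷ x)  (true ∷ y)  with x · y | wt-⊕ x y
-- A common 1 flips the inner product: `twice` rises from 0 to 2 here and falls from 2 to 0 in the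
-- other case, so the left side grows by 4 or by 0.
... | false | k , eq = suc k , trans (lemma (wt x) (wt y)) (trans (cong (4 ℕ.+_) eq) (lemma′ (wt (x ⊕ y)) k))
  where
  lemma : ∀ a b → suc a ℕ.+ suc b ℕ.+ 2 ≡ 4 ℕ.+ (a ℕ.+ b ℕ.+ 0)
  lemma = ℕ-solve-∀
  lemma′ : ∀ a k → 4 ℕ.+ (a ℕ.+ k ℕ.* 4) ≡ a ℕ.+ suc k ℕ.* 4
  lemma′ = ℕ-solve-∀
... | true  | k , eq = k , trans (lemma (wt x) (wt y)) eq
  where
  lemma : ∀ a b → suc a ℕ.+ suc b ℕ.+ 0 ≡ a ℕ.+ b ℕ.+ 2
  lemma = ℕ-solve-∀

wt-⊕-%4 : (x y : Word n) → wt (x ⊕ y) % 4 ≡ (wt x % 4 ℕ.+ wt y % 4 ℕ.+ twice (x · y)) % 4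
wt-⊕-%4 x y with k , eq ← wt-⊕ x y = begin
  wt (x ⊕ y) % 4                                  ≡⟨ [m+kn]%n≡m%n (wt (x ⊕ y)) k 4 ⟨
  (wt (x ⊕ y) ℕ.+ k ℕ.* 4) % 4                    ≡⟨ cong (_% 4) eq ⟨
  (wt x ℕ.+ wt y ℕ.+ t) % 4                       ≡⟨ %-distribˡ-+ (wt x ℕ.+ wt y) t 4 ⟩
  ((wt x ℕ.+ wt y) % 4 ℕ.+ t % 4) % 4             ≡⟨ cong (λ r → (r ℕ.+ t % 4) % 4) (%-distribˡ-+ (wt x) (wt y) 4) ⟩
  ((wt x % 4 ℕ.+ wt y % 4) % 4 ℕ.+ t % 4) % 4     ≡⟨ %-distribˡ-+ (wt x % 4 ℕ.+ wt y % 4) t 4 ⟨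
  (wt x % 4 ℕ.+ wt y % 4 ℕ.+ t) % 4               ∎
  where t = twice (x · y)

-- Since x ⊕ x has weight 0, this ties the parity of the weight to `x · x`; the next two lemmas read
-- it off residue by residue.
self-⊕-%4 : (x : Word n) → (wt x % 4 ℕ.+ wt x % 4 ℕ.+ twice (x · x)) % 4 ≡ 0
self-⊕-%4 {n} x = begin
  (wt x % 4 ℕ.+ wt x % 4 ℕ.+ twice (x · x)) % 4 ≡⟨ wt-⊕-%4 x x ⟨
  wt (x ⊕ x) % 4                                ≡⟨ cong (λ y → wt y % 4) (⊕-self x) ⟩
  wt (𝟎 {n}) % 4                                ≡⟨ cong (_% 4) (wt-𝟎 n) ⟩
  0                                             ∎

wt≡1⇒self≡true : (x : Word n) → wt x % 4 ≡ 1 → x · x ≡ true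
wt≡1⇒self≡true x wt≡1 with wt x % 4 | x · x | self-⊕-%4 x
wt≡1⇒self≡true x refl | _ | true  | _  = refl
wt≡1⇒self≡true x refl | _ | false | ()

self≡false⇒even : (x : Word n) → x · x ≡ false → wt x % 4 ≡ 0 ⊎ wt x % 4 ≡ 2
self≡false⇒even x x·x≡0 with wt x % 4 | m%n<n (wt x) 4 | x · x | self-⊕-%4 x
self≡false⇒even x refl | 0 | _ | _ | _ = inj₁ refl
self≡false⇒even x refl | 1 | _ | _ | ()
self≡false⇒even x refl | 2 | _ | _ | _ = inj₂ refl
self≡false⇒even x refl | 3 | _ | _ | ()
self≡false⇒even x refl | suc (suc (suc (suc _))) | s≤s (s≤s (s≤s (s≤s ()))) | _ | _

-- Sums over 𝔽₂ⁿ

∑ : (Word n → ℤ) → ℤ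
∑ {zero}  φ = φ []
∑ {suc n} φ = ∑ (λ x → φ (false ∷ x)) + ∑ (λ x → φ (true ∷ x))

∑-cong : {φ ψ : Word n → ℤ} → (∀ x → φ x ≡ ψ x) → ∑ φ ≡ ∑ ψ
∑-cong {zero}  eq = eq []
∑-cong {suc n} eq = cong₂ _+_ (∑-cong λ x → eq (false ∷ x)) (∑-cong λ x → eq (true ∷ x))

left-comm : ∀ a b c → a * (b * c) ≡ b * (a * c)
left-comm = solve-∀

+-interchange : ∀ a b c d → (a + b) + (c + d) ≡ (a + c) + (b + d)
+-interchange = solve-∀

∑-+ : (φ ψ : Word n → ℤ) → ∑ (λ x → φ x + ψ x) ≡ ∑ φ + ∑ ψ
∑-+ {zero}  φ ψ = refl
∑-+ {suc n} φ ψ = trans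
  (cong₂ _+_ (∑-+ (φ ∘ (false ∷_)) (ψ ∘ (false ∷_))) (∑-+ (φ ∘ (true ∷_)) (ψ ∘ (true ∷_))))
  (+-interchange (∑ (φ ∘ (false ∷_))) (∑ (ψ ∘ (false ∷_))) (∑ (φ ∘ (true ∷_))) (∑ (ψ ∘ (true ∷_))))

∑-*ˡ : (c : ℤ) (φ : Word n → ℤ) → ∑ (λ x → c * φ x) ≡ c * ∑ φ
∑-*ˡ {zero}  c φ = refl
∑-*ˡ {suc n} c φ = trans
  (cong₂ _+_ (∑-*ˡ c (φ ∘ (false ∷_))) (∑-*ˡ c (φ ∘ (true ∷_))))
  (sym (ℤ.*-distribˡ-+ c (∑ (φ ∘ (false ∷_))) (∑ (φ ∘ (true ∷_)))))

∑-neg : (φ : Word n → ℤ) → ∑ (λ x → - φ x) ≡ - ∑ φ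
∑-neg φ = begin
  ∑ (λ x → - φ x)     ≡⟨ ∑-cong (λ x → ℤ.-1*i≡-i (φ x)) ⟨
  ∑ (λ x → -1ℤ * φ x) ≡⟨ ∑-*ˡ -1ℤ φ ⟩
  -1ℤ * ∑ φ           ≡⟨ ℤ.-1*i≡-i (∑ φ) ⟩
  - ∑ φ               ∎

∑-swap : ∀ {m n} (φ : Word m → Word n → ℤ) → ∑ (λ x → ∑ (λ y → φ x y)) ≡ ∑ (λ y → ∑ (λ x → φ x y))
∑-swap {zero}  φ = refl
∑-swap {suc m} φ = trans
  (cong₂ _+_ (∑-swap (φ ∘ (false ∷_))) (∑-swap (φ ∘ (true ∷_))))
  (sym (∑-+ (λ y → ∑ λ x → φ (false ∷ x) y) (λ y → ∑ λ x → φ (true ∷ x) y)))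

∑-translate : (t : Word n) (φ : Word n → ℤ) → ∑ φ ≡ ∑ (λ x → φ (x ⊕ t))
∑-translate []          φ = refl
∑-translate (false ∷ t) φ = cong₂ _+_ (∑-translate t (φ ∘ (false ∷_))) (∑-translate t (φ ∘ (true ∷_)))
-- A 1 in the translation exchanges the two halves of the sum.
∑-translate (true ∷ t)  φ = trans
  (cong₂ _+_ (∑-translate t (φ ∘ (false ∷_))) (∑-translate t (φ ∘ (true ∷_))))
  (ℤ.+-comm (∑ (λ x → φ (false ∷ (x ⊕ t)))) (∑ (λ x → φ (true ∷ (x ⊕ t)))))

∑-∣ : (m : ℤ) {φ : Word n → ℤ} → (∀ x → m ∣ φ x) → m ∣ ∑ φ
∑-∣ {zero}  m m∣φ = m∣φ []
∑-∣ {suc n} m m∣φ = ∣m∣n⇒∣m+n (∑-∣ m λ x → m∣φ (false ∷ x)) (∑-∣ m λ x → m∣φ (true ∷ x))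

i≡-i⇒i≡0 : ∀ {i} → i ≡ - i → i ≡ 0ℤ
i≡-i⇒i≡0 {i} eq = ℤ.*-cancelˡ-≡ (+ 2) i 0ℤ (begin
  + 2 * i ≡⟨ lemma i ⟩
  i + i   ≡⟨ cong (_+_ i) eq ⟩
  i - i   ≡⟨ ℤ.+-inverseʳ i ⟩
  0ℤ      ∎)
  where
  lemma : ∀ i → + 2 * i ≡ i + i
  lemma = solve-∀

-- Indicator functions and counting

𝟙 : ∀ {a} {A : Set a} → Dec A → ℤ
𝟙 A? = if does A? then 1ℤ else 0ℤ

𝟙-⇔ : ∀ {a b} {A : Set a} {B : Set b} → A ⇔ B → (A? : Dec A) (B? : Dec B) → 𝟙 A? ≡ 𝟙 B?
𝟙-⇔ A⇔B A? B? = cong (if_then 1ℤ else 0ℤ) (does-⇔ A⇔B A? B?)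

length-filter-map : ∀ {a p} {A B : Set a} {P : Unary.Pred B p} (P? : Unary.Decidable P) (f : A → B) (xs : List A) →
                    length (filter P? (map f xs)) ≡ length (filter (P? ∘ f) xs)
length-filter-map P? f [] = refl
length-filter-map P? f (x ∷ xs) with does (P? (f x))
... | true  = cong suc (length-filter-map P? f xs)
... | false = length-filter-map P? f xs

-- Bridge from the list counts that define weight enumerators to integer sums.
length-filter-allWords : ∀ {p} {P : Unary.Pred (Word n) p} (P? : Unary.Decidable P) →
                         + length (filter P? (allWords n)) ≡ ∑ (λ x → 𝟙 (P? x))
length-filter-allWords {zero}  P? with does (P? [])
... | true  = refl
... | false = refl
length-filter-allWords {suc n} P? = begin
  + length (filter P? (xs ++ ys))
    ≡⟨ cong (+_ ∘ length) (filter-++ P? xs ys) ⟩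
  + length (filter P? xs ++ filter P? ys)
    ≡⟨ cong +_ (length-++ (filter P? xs)) ⟩
  + length (filter P? xs) + + length (filter P? ys)
    ≡⟨ cong₂ (λ i j → + i + + j) (length-filter-map P? (false ∷_) (allWords n)) (length-filter-map P? (true ∷_) (allWords n)) ⟩
  + length (filter (P? ∘ (false ∷_)) (allWords n)) + + length (filter (P? ∘ (true ∷_)) (allWords n))
    ≡⟨ cong₂ _+_ (length-filter-allWords (P? ∘ (false ∷_))) (length-filter-allWords (P? ∘ (true ∷_))) ⟩
  ∑ (λ x → 𝟙 (P? (false ∷ x))) + ∑ (λ x → 𝟙 (P? (true ∷ x))) ∎
  where
  xs = map (false ∷_) (allWords n)
  ys = map (true ∷_) (allWords n)

-- Characters

sgn : Bool → ℤ
sgn b = if b then -1ℤ else 1ℤ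

sgn-not : ∀ b → sgn (not b) ≡ - sgn b
sgn-not false = refl
sgn-not true  = refl

sgn-xor : ∀ a b → sgn (a xor b) ≡ sgn a * sgn b
sgn-xor false b = sym (ℤ.*-identityˡ (sgn b))
sgn-xor true  b = trans (sgn-not b) (sym (ℤ.-1*i≡-i (sgn b)))

-- The inner character sum is 2ⁿ at `v = 𝟎` and 0 elsewhere. In the induction, words `v` starting
-- with 1 drop out, as the two values of the first bit of `u` cancel.
fourier-inversion-at-𝟎 : (φ : Word n → ℤ) → ∑ (λ v → φ v * ∑ (λ u → sgn (u · v))) ≡ + (2 ℕ.^ n) * φ 𝟎
fourier-inversion-at-𝟎 {zero}  φ = ℤ.*-comm (φ []) 1ℤ
fourier-inversion-at-𝟎 {suc n} φ = begin
  ∑ (λ v → φ (false ∷ v) * (χ v + χ v)) + ∑ (λ v → φ (true ∷ v) * (χ v + ∑ (λ u → sgn (not (u · v)))))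
    ≡⟨ cong₂ _+_ (∑-cong λ v → double (φ (false ∷ v)) (χ v)) (∑-cong λ v → vanish (φ (true ∷ v)) v) ⟩
  ∑ (λ v → + 2 * (φ (false ∷ v) * χ v)) + ∑ (λ v → 0ℤ * χ v)
    ≡⟨ cong₂ _+_ (∑-*ˡ (+ 2) (λ v → φ (false ∷ v) * χ v)) (∑-*ˡ 0ℤ χ) ⟩
  + 2 * ∑ (λ v → φ (false ∷ v) * χ v) + 0ℤ * ∑ χ
    ≡⟨ cong₂ _+_ (cong (+ 2 *_) (fourier-inversion-at-𝟎 (φ ∘ (false ∷_)))) refl ⟩
  + 2 * (+ (2 ℕ.^ n) * φ 𝟎) + 0ℤ
    ≡⟨ ℤ.+-identityʳ _ ⟩
  + 2 * (+ (2 ℕ.^ n) * φ 𝟎)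
    ≡⟨ ℤ.*-assoc (+ 2) (+ (2 ℕ.^ n)) (φ 𝟎) ⟨
  + 2 * + (2 ℕ.^ n) * φ 𝟎
    ≡⟨ cong (_* φ 𝟎) (ℤ.pos-* 2 (2 ℕ.^ n)) ⟨
  + (2 ℕ.^ suc n) * φ 𝟎 ∎
  where
  χ : Word n → ℤ
  χ v = ∑ (λ u → sgn (u · v))

  double : ∀ a b → a * (b + b) ≡ + 2 * (a * b)
  double = solve-∀

  vanish : ∀ a v → a * (χ v + ∑ (λ u → sgn (not (u · v)))) ≡ 0ℤ * χ v
  vanish a v = begin
    a * (χ v + ∑ (λ u → sgn (not (u · v)))) ≡⟨ cong (λ z → a * (χ v + z)) (∑-cong λ u → sgn-not (u · v)) ⟩
    a * (χ v + ∑ (λ u → - sgn (u · v)))     ≡⟨ cong (λ z → a * (χ v + z)) (∑-neg (λ u → sgn (u · v))) ⟩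
    a * (χ v - χ v)                         ≡⟨ cong (a *_) (ℤ.+-inverseʳ (χ v)) ⟩
    a * 0ℤ                                  ≡⟨ ℤ.*-zeroʳ a ⟩
    0ℤ                                      ∎

-- Transforms of functions of the weight

-- A list stands for the sequence that continues it by zeros.
infix 9 _!_

_!_ : List ℤ → ℕ → ℤ
[]      ! k     = 0ℤ
(a ∷ l) ! zero  = a
(a ∷ l) ! suc k = l ! k

-- The operator 1 + σE, where E is the shift of sequences. With σ = 1 or -1 it sums out one bit of
-- `u` against a bit 0 or 1 of `x`.
1+[_]E : ℤ → List ℤ → List ℤ
1+[ σ ]E []      = []
1+[ σ ]E (a ∷ l) = (a + σ * l ! 0) ∷ 1+[ σ ]E l

1+E-! : ∀ σ l k → 1+[ σ ]E l ! k ≡ l ! k + σ * l ! suc k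
1+E-! σ []      k       = sym (trans (ℤ.+-identityˡ _) (ℤ.*-zeroʳ σ))
1+E-! σ (a ∷ l) zero    = refl
1+E-! σ (a ∷ l) (suc k) = 1+E-! σ l k

1+E-comm : ∀ σ τ l → 1+[ σ ]E (1+[ τ ]E l) ≡ 1+[ τ ]E (1+[ σ ]E l)
1+E-comm σ τ []      = refl
1+E-comm σ τ (a ∷ l) = cong₂ _∷_ head≡ (1+E-comm σ τ l)
  where
  expand : ∀ σ τ a b c → a + τ * b + σ * (b + τ * c) ≡ a + σ * b + τ * (b + σ * c)
  expand = solve-∀
  head≡ : a + τ * l ! 0 + σ * 1+[ τ ]E l ! 0 ≡ a + σ * l ! 0 + τ * 1+[ σ ]E l ! 0
  head≡ rewrite 1+E-! σ l 0 | 1+E-! τ l 0 = expand σ τ a (l ! 0) (l ! 1)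

iterate-comm : ∀ {a} {A : Set a} {f g : A → A} → (∀ x → f (g x) ≡ g (f x)) →
               ∀ k x → iterate f (g x) k ≡ g (iterate f x k)
iterate-comm         comm zero    x = refl
iterate-comm {f = f} comm (suc k) x = trans (cong (λ y → iterate f y k) (comm x)) (iterate-comm comm k (f x))

-- ∑ⱼ gⱼ Kⱼ(w), with Kⱼ the Krawtchouk polynomials of length n.
krawtchouk : ℕ → List ℤ → ℕ → ℤ
krawtchouk n g w = iterate 1+[ -1ℤ ]E (iterate 1+[ 1ℤ ]E g (n ∸ w)) w ! 0

-- Summing over the bits of `u` one at a time, each 0 of `x` applies 1 + E to `g` and each 1 applies
-- 1 - E. What remains is the entry at 0 of (1 + E)ⁿ⁻ʷ (1 - E)ʷ g, where w = wt x.
∑-krawtchouk : (g : List ℤ) (x : Word n) → ∑ (λ u → g ! wt u * sgn (u · x)) ≡ krawtchouk n g (wt x)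
∑-krawtchouk         g []          = ℤ.*-identityʳ (g ! 0)
∑-krawtchouk {suc n} g (false ∷ x) = begin
  ∑ (λ u → g ! wt u * sgn (u · x)) + ∑ (λ u → g ! suc (wt u) * sgn (u · x))
    ≡⟨ ∑-+ (λ u → g ! wt u * sgn (u · x)) (λ u → g ! suc (wt u) * sgn (u · x)) ⟨
  ∑ (λ u → g ! wt u * sgn (u · x) + g ! suc (wt u) * sgn (u · x))
    ≡⟨ ∑-cong (λ u → collect (g ! wt u) (g ! suc (wt u)) (sgn (u · x))) ⟩
  ∑ (λ u → (g ! wt u + 1ℤ * g ! suc (wt u)) * sgn (u · x))
    ≡⟨ ∑-cong (λ u → cong (_* sgn (u · x)) (1+E-! 1ℤ g (wt u))) ⟨
  ∑ (λ u → 1+[ 1ℤ ]E g ! wt u * sgn (u · x))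
    ≡⟨ ∑-krawtchouk (1+[ 1ℤ ]E g) x ⟩
  iterate 1+[ -1ℤ ]E (iterate 1+[ 1ℤ ]E g (suc (n ∸ wt x))) (wt x) ! 0
    ≡⟨ cong (λ k → iterate 1+[ -1ℤ ]E (iterate 1+[ 1ℤ ]E g k) (wt x) ! 0) (ℕ.+-∸-assoc 1 (wt≤n x)) ⟨
  krawtchouk (suc n) g (wt x) ∎
  where
  collect : ∀ a b c → a * c + b * c ≡ (a + 1ℤ * b) * c
  collect = solve-∀
∑-krawtchouk {suc n} g (true ∷ x)  = begin
  ∑ (λ u → g ! wt u * sgn (u · x)) + ∑ (λ u → g ! suc (wt u) * sgn (not (u · x)))
    ≡⟨ ∑-+ (λ u → g ! wt u * sgn (u · x)) (λ u → g ! suc (wt u) * sgn (not (u · x))) ⟨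
  ∑ (λ u → g ! wt u * sgn (u · x) + g ! suc (wt u) * sgn (not (u · x)))
    ≡⟨ ∑-cong (λ u → trans (cong (λ z → g ! wt u * sgn (u · x) + g ! suc (wt u) * z) (sgn-not (u · x)))
                           (collect (g ! wt u) (g ! suc (wt u)) (sgn (u · x)))) ⟩
  ∑ (λ u → (g ! wt u + -1ℤ * g ! suc (wt u)) * sgn (u · x))
    ≡⟨ ∑-cong (λ u → cong (_* sgn (u · x)) (1+E-! -1ℤ g (wt u))) ⟨
  ∑ (λ u → 1+[ -1ℤ ]E g ! wt u * sgn (u · x))
    ≡⟨ ∑-krawtchouk (1+[ -1ℤ ]E g) x ⟩
  -- The new factor 1 - E is innermost and has to move past all factors 1 + E.
  iterate 1+[ -1ℤ ]E (iterate 1+[ 1ℤ ]E (1+[ -1ℤ ]E g) (n ∸ wt x)) (wt x) ! 0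
    ≡⟨ cong (λ l → iterate 1+[ -1ℤ ]E l (wt x) ! 0) (iterate-comm (1+E-comm 1ℤ -1ℤ) (n ∸ wt x) g) ⟩
  krawtchouk (suc n) g (suc (wt x)) ∎
  where
  collect : ∀ a b c → a * c + b * - c ≡ (a + -1ℤ * b) * c
  collect = solve-∀

-- Comparing squares avoids having to determine the sign of n.
distinct-eigenvalues : ∀ m n x → m * m ≢ n * n → m * x ≡ - n * x → x ≡ 0ℤ
distinct-eigenvalues m n x m²≢n² m*x≡-n*x with x ℤ.≟ 0ℤ
... | yes x≡0 = x≡0
... | no  x≢0 = contradiction (ℤ.*-cancelʳ-≡ (m * m) (n * n) x {{≢-nonZero x≢0}} (begin
  m * m * x       ≡⟨ ℤ.*-assoc m m x ⟩
  m * (m * x)     ≡⟨ cong (m *_) m*x≡-n*x ⟩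
  m * (- n * x)   ≡⟨ swap m n x ⟩
  - n * (m * x)   ≡⟨ cong (- n *_) m*x≡-n*x ⟩
  - n * (- n * x) ≡⟨ square n x ⟩
  n * n * x       ∎)) m²≢n²
  where
  swap : ∀ a b c → a * (- b * c) ≡ - b * (a * c)
  swap = solve-∀
  square : ∀ a b → - a * (- a * b) ≡ a * a * b
  square = solve-∀

-- Self-dual codes and their shadows

𝟙[_] : Code n → Word n → ℤ
𝟙[ C ] x = 𝟙 (codeword? C x)

card : Code n → ℤ
card C = ∑ 𝟙[ C ]

-- For s in the shadow s ⊕ C of C, this is up to a global sign the difference
-- of the indicator functions of its two cosets C₁ and C₃ of C₀.
F : Code n → Word n → Word n → ℤ
F C s x = 𝟙[ C ] (x ⊕ s) * sgn (s · x)

module _ (C : Code n) (C≐C^⊥ : SelfDual C) where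

  orthogonal : ∀ {x y} → x ∈ Codeword C → y ∈ Codeword C → x · y ≡ false
  orthogonal {y = y} x∈C y∈C = proj₁ C≐C^⊥ x∈C y y∈C

  codeword-even : ∀ {x} → x ∈ Codeword C → wt x % 4 ≡ 0 ⊎ wt x % 4 ≡ 2
  codeword-even {x} x∈C = self≡false⇒even x (orthogonal x∈C x∈C)

  𝟏∈C : 𝟏 ∈ Codeword C
  𝟏∈C = proj₂ C≐C^⊥ λ y y∈C → begin
    𝟏 · y ≡⟨ ·-comm 𝟏 y ⟩
    y · 𝟏 ≡⟨ ·-𝟏 y ⟩
    y · y ≡⟨ orthogonal y∈C y∈C ⟩
    false ∎

  ⊕-∈-⇔ : ∀ {t} x → t ∈ Codeword C → (x ⊕ t ∈ Codeword C) ⇔ (x ∈ Codeword C)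
  ⊕-∈-⇔ {t} x t∈C = mk⇔
    (λ x⊕t∈C → subst (Codeword C) (⊕-cancelʳ x t) (⊕-closed C x⊕t∈C t∈C))
    (λ x∈C → ⊕-closed C x∈C t∈C)

  shadow-·-even : ∀ {s c} → s ∈ Shadow C → c ∈ Codeword C → wt c % 4 ≡ 0 → s · c ≡ false
  shadow-·-even {c = c} (s∈C₀^⊥ , _) c∈C wt≡0 = s∈C₀^⊥ c (c∈C , wt≡0)

  -- If `s · c` were 0, then for each codeword `y` of weight 2 mod 4 the word `y ⊕ c` would lie in
  -- C₀, giving `s · y` = 0. So `s` would be orthogonal to all of C and hence lie in C.
  shadow-·-odd : ∀ {s c} → s ∈ Shadow C → c ∈ Codeword C → wt c % 4 ≡ 2 → s · c ≡ true
  shadow-·-odd {s} {c} s∈S@(_ , s∉C) c∈C wtc≡2 = Bool.¬-not λ s·c≡0 →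
    s∉C (proj₂ C≐C^⊥ λ y y∈C → case codeword-even y∈C of λ where
      (inj₁ wty≡0) → shadow-·-even s∈S y∈C wty≡0
      (inj₂ wty≡2) → begin
        s · y               ≡⟨ Bool.xor-identityʳ (s · y) ⟨
        (s · y) xor false   ≡⟨ cong ((s · y) xor_) s·c≡0 ⟨
        (s · y) xor (s · c) ≡⟨ ·-distribˡ-⊕ s y c ⟨
        s · (y ⊕ c)         ≡⟨ shadow-·-even s∈S (⊕-closed C y∈C c∈C) (begin
          wt (y ⊕ c) % 4                                ≡⟨ wt-⊕-%4 y c ⟩
          (wt y % 4 ℕ.+ wt c % 4 ℕ.+ twice (y · c)) % 4 ≡⟨ cong₂ (λ i b → (i ℕ.+ wt c % 4 ℕ.+ twice b) % 4) wty≡2 (orthogonal y∈C c∈C) ⟩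
          (2 ℕ.+ wt c % 4 ℕ.+ 0) % 4                    ≡⟨ cong (λ i → (2 ℕ.+ i ℕ.+ 0) % 4) wtc≡2 ⟩
          0                                             ∎) ⟩
        false               ∎)

  -- The inner product of a shadow vector with a codeword depends only on the weight of the codeword
  -- mod 4, so those of `x` and `s` cancel. With the next lemma this gives S = s ⊕ C.
  shadow-⊕-shadow : ∀ {s x} → s ∈ Shadow C → x ∈ Shadow C → x ⊕ s ∈ Codeword C
  shadow-⊕-shadow {s} {x} s∈S x∈S = proj₂ C≐C^⊥ λ c c∈C → trans (·-distribʳ-⊕ c x s)
    (case codeword-even c∈C of λ where
      (inj₁ wt≡0) → cong₂ _xor_ (shadow-·-even x∈S c∈C wt≡0) (shadow-·-even s∈S c∈C wt≡0)
      (inj₂ wt≡2) → cong₂ _xor_ (shadow-·-odd x∈S c∈C wt≡2) (shadow-·-odd s∈S c∈C wt≡2))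

  codeword-⊕-shadow : ∀ {s x} → s ∈ Shadow C → x ⊕ s ∈ Codeword C → x ∈ Shadow C
  codeword-⊕-shadow {s} {x} s∈S@(s∈C₀^⊥ , s∉C) x⊕s∈C = x∈C₀^⊥ , x∉C
    where
    x∈C₀^⊥ : x ∈ DoublyEvenSubcode C ^⊥
    x∈C₀^⊥ y y∈C₀@(y∈C , _) = begin
      x · y                   ≡⟨ cong (_· y) (⊕-cancelʳ x s) ⟨
      ((x ⊕ s) ⊕ s) · y       ≡⟨ ·-distribʳ-⊕ y (x ⊕ s) s ⟩
      (x ⊕ s) · y xor (s · y) ≡⟨ cong₂ _xor_ (orthogonal x⊕s∈C y∈C) (s∈C₀^⊥ y y∈C₀) ⟩
      false                   ∎

    x∉C : ¬ x ∈ Codeword C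
    x∉C x∈C = s∉C (subst (Codeword C) eq (⊕-closed C x⊕s∈C x∈C))
      where
      eq : (x ⊕ s) ⊕ x ≡ s
      eq = trans (cong (_⊕ x) (⊕-comm x s)) (⊕-cancelʳ s x)

  -- For c = x ⊕ s, both kinds of codeword satisfy wt c + 2 (s · c) ≡ 0 (mod 4).
  shadow-wt-%4 : ∀ {s x} → s ∈ Shadow C → x ⊕ s ∈ Codeword C → wt x % 4 ≡ wt s % 4
  shadow-wt-%4 {s} {x} s∈S c∈C = begin
    wt x % 4                                        ≡⟨ cong (λ y → wt y % 4) (⊕-cancelʳ x s) ⟨
    wt (c ⊕ s) % 4                                  ≡⟨ wt-⊕-%4 c s ⟩
    (wt c % 4 ℕ.+ wt s % 4 ℕ.+ twice (c · s)) % 4   ≡⟨ cong (λ b → (wt c % 4 ℕ.+ wt s % 4 ℕ.+ twice b) % 4) (·-comm c s) ⟩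
    (wt c % 4 ℕ.+ wt s % 4 ℕ.+ twice (s · c)) % 4   ≡⟨ reduce (codeword-even c∈C) ⟩
    wt s % 4                                        ∎
    where
    c = x ⊕ s
    r+4k : ∀ k → (wt s % 4 ℕ.+ k ℕ.* 4) % 4 ≡ wt s % 4
    r+4k k = trans ([m+kn]%n≡m%n (wt s % 4) k 4) (m%n%n≡m%n (wt s) 4)
    reduce : wt c % 4 ≡ 0 ⊎ wt c % 4 ≡ 2 → (wt c % 4 ℕ.+ wt s % 4 ℕ.+ twice (s · c)) % 4 ≡ wt s % 4
    reduce (inj₁ wt≡0) rewrite shadow-·-even s∈S c∈C wt≡0 | wt≡0 = r+4k 0
    reduce (inj₂ wt≡2) rewrite shadow-·-odd s∈S c∈C wt≡2 | wt≡2 =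
      trans (cong (_% 4) (collect (wt s % 4))) (r+4k 1)
      where
      collect : ∀ r → 2 ℕ.+ r ℕ.+ 2 ≡ r ℕ.+ 4
      collect = ℕ-solve-∀

  𝟙-⊕ : ∀ {t} x → t ∈ Codeword C → 𝟙[ C ] (x ⊕ t) ≡ 𝟙[ C ] x
  𝟙-⊕ {t} x t∈C = 𝟙-⇔ (⊕-∈-⇔ x t∈C) (codeword? C (x ⊕ t)) (codeword? C x)

  -- On C the character of `u` is trivial if `u` is in C; otherwise translation by a codeword `t`
  -- with `u · t` = 1 negates the sum.
  𝟙-transform : ∀ u → ∑ (λ c → 𝟙[ C ] c * sgn (u · c)) ≡ card C * 𝟙[ C ] u
  𝟙-transform u with codeword? C u
  ... | yes u∈C = trans (∑-cong trivial) (sym (ℤ.*-identityʳ (card C)))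
    where
    trivial : ∀ c → 𝟙[ C ] c * sgn (u · c) ≡ 𝟙[ C ] c
    trivial c with codeword? C c
    ... | yes c∈C rewrite orthogonal u∈C c∈C = refl
    ... | no  _   = refl
  ... | no u∉C = trans (i≡-i⇒i≡0 odd) (sym (ℤ.*-zeroʳ (card C)))
    where
    φ : Word n → ℤ
    φ c = 𝟙[ C ] c * sgn (u · c)

    nontrivial : ∃[ t ] t ∈ Codeword C × u · t ≡ true
    -- An exhaustive search over all words produces the witness constructively.
    nontrivial with anySubset? (λ t → codeword? C t ×-dec (u · t Bool.≟ true))
    ... | yes t = t
    ... | no ∄t = contradiction (proj₂ C≐C^⊥ λ y y∈C → Bool.¬-not λ u·y≡1 → ∄t (y , y∈C , u·y≡1)) u∉C

    odd : ∑ φ ≡ - ∑ φ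
    odd with t , t∈C , u·t≡1 ← nontrivial = begin
      ∑ φ                 ≡⟨ ∑-translate t φ ⟩
      ∑ (λ c → φ (c ⊕ t)) ≡⟨ ∑-cong flip ⟩
      ∑ (λ c → - φ c)     ≡⟨ ∑-neg φ ⟩
      - ∑ φ               ∎
      where
      flip : ∀ c → φ (c ⊕ t) ≡ - φ c
      flip c = begin
        𝟙[ C ] (c ⊕ t) * sgn (u · (c ⊕ t))           ≡⟨ cong₂ (λ i b → i * sgn b) (𝟙-⊕ c t∈C) (·-distribˡ-⊕ u c t) ⟩
        𝟙[ C ] c * sgn ((u · c) xor (u · t))         ≡⟨ cong (λ b → 𝟙[ C ] c * sgn ((u · c) xor b)) u·t≡1 ⟩
        𝟙[ C ] c * sgn ((u · c) xor true)            ≡⟨ cong (𝟙[ C ] c *_) (sgn-xor (u · c) true) ⟩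
        𝟙[ C ] c * (sgn (u · c) * -1ℤ)               ≡⟨ lemma (𝟙[ C ] c) (sgn (u · c)) ⟩
        - (𝟙[ C ] c * sgn (u · c))                   ∎
        where
        lemma : ∀ a b → a * (b * -1ℤ) ≡ - (a * b)
        lemma = solve-∀

  -- Sum `𝟙-transform` over all `u` and exchange the sums; only the codeword `𝟎` contributes.
  card² : card C * card C ≡ + (2 ℕ.^ n)
  card² = begin
    card C * card C                                  ≡⟨ ∑-*ˡ (card C) 𝟙[ C ] ⟨
    ∑ (λ u → card C * 𝟙[ C ] u)                       ≡⟨ ∑-cong 𝟙-transform ⟨
    ∑ (λ u → ∑ (λ c → 𝟙[ C ] c * sgn (u · c)))     ≡⟨ ∑-swap (λ u c → 𝟙[ C ] c * sgn (u · c)) ⟩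
    ∑ (λ c → ∑ (λ u → 𝟙[ C ] c * sgn (u · c)))     ≡⟨ ∑-cong (λ c → ∑-*ˡ (𝟙[ C ] c) (λ u → sgn (u · c))) ⟩
    ∑ (λ c → 𝟙[ C ] c * ∑ (λ u → sgn (u · c)))     ≡⟨ fourier-inversion-at-𝟎 𝟙[ C ] ⟩
    + (2 ℕ.^ n) * 𝟙[ C ] 𝟎                         ≡⟨ cong (λ b → + (2 ℕ.^ n) * (if b then 1ℤ else 0ℤ)) (dec-true (codeword? C 𝟎) (𝟎-closed C)) ⟩
    + (2 ℕ.^ n) * 1ℤ                           ≡⟨ ℤ.*-identityʳ _ ⟩
    + (2 ℕ.^ n)                                ∎

  -- Symmetries of `F` under transform and complement

  module _ (s : Word n) (s·s≡1 : s · s ≡ true) where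

    -- After translation by `s` the characters of `u` and `s` combine to that of `u ⊕ s` on C. The
    -- minus sign of the eigenvalue is the sign of `s · s`.
    F-transform : ∀ u → ∑ (λ x → F C s x * sgn (u · x)) ≡ - (card C * F C s u)
    F-transform u = begin
      ∑ (λ x → F C s x * sgn (u · x))
        ≡⟨ ∑-translate s (λ x → F C s x * sgn (u · x)) ⟩
      ∑ (λ c → F C s (c ⊕ s) * sgn (u · (c ⊕ s)))
        ≡⟨ ∑-cong expand ⟩
      ∑ (λ c → - sgn (u · s) * (𝟙[ C ] c * sgn ((u ⊕ s) · c)))
        ≡⟨ ∑-*ˡ (- sgn (u · s)) (λ c → 𝟙[ C ] c * sgn ((u ⊕ s) · c)) ⟩
      - sgn (u · s) * ∑ (λ c → 𝟙[ C ] c * sgn ((u ⊕ s) · c))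
        ≡⟨ cong₂ (λ b z → - sgn b * z) (·-comm u s) (𝟙-transform (u ⊕ s)) ⟩
      - sgn (s · u) * (card C * 𝟙[ C ] (u ⊕ s))
        ≡⟨ rearrange (sgn (s · u)) (card C) (𝟙[ C ] (u ⊕ s)) ⟩
      - (card C * F C s u) ∎
      where
      rearrange : ∀ a b c → - a * (b * c) ≡ - (b * (c * a))
      rearrange = solve-∀

      regroup : ∀ i a b c → i * (a * -1ℤ) * (b * c) ≡ - c * (i * (b * a))
      regroup = solve-∀

      expand : ∀ c → F C s (c ⊕ s) * sgn (u · (c ⊕ s)) ≡ - sgn (u · s) * (𝟙[ C ] c * sgn ((u ⊕ s) · c))
      expand c = begin
        𝟙[ C ] ((c ⊕ s) ⊕ s) * sgn (s · (c ⊕ s)) * sgn (u · (c ⊕ s))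
          ≡⟨ cong₂ (λ y b → 𝟙[ C ] y * sgn b * sgn (u · (c ⊕ s))) (⊕-cancelʳ c s) (·-distribˡ-⊕ s c s) ⟩
        𝟙[ C ] c * sgn ((s · c) xor (s · s)) * sgn (u · (c ⊕ s))
          ≡⟨ cong₂ (λ b b′ → 𝟙[ C ] c * sgn ((s · c) xor b) * sgn b′) s·s≡1 (·-distribˡ-⊕ u c s) ⟩
        𝟙[ C ] c * sgn ((s · c) xor true) * sgn ((u · c) xor (u · s))
          ≡⟨ cong₂ (λ i j → 𝟙[ C ] c * i * j) (sgn-xor (s · c) true) (sgn-xor (u · c) (u · s)) ⟩
        𝟙[ C ] c * (sgn (s · c) * -1ℤ) * (sgn (u · c) * sgn (u · s))
          ≡⟨ regroup (𝟙[ C ] c) (sgn (s · c)) (sgn (u · c)) (sgn (u · s)) ⟩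
        - sgn (u · s) * (𝟙[ C ] c * (sgn (u · c) * sgn (s · c)))
          ≡⟨ cong (λ z → - sgn (u · s) * (𝟙[ C ] c * z)) (sgn-xor (u · c) (s · c)) ⟨
        - sgn (u · s) * (𝟙[ C ] c * sgn ((u · c) xor (s · c)))
          ≡⟨ cong (λ b → - sgn (u · s) * (𝟙[ C ] c * sgn b)) (·-distribʳ-⊕ c u s) ⟨
        - sgn (u · s) * (𝟙[ C ] c * sgn ((u ⊕ s) · c)) ∎

    -- Exchanging the sums moves the transform from `g` to the eigenvector `F C s`.
    F-krawtchouk : (g : List ℤ) → ∑ (λ x → F C s x * krawtchouk n g (wt x)) ≡ - card C * ∑ (λ x → F C s x * g ! wt x)
    F-krawtchouk g = begin
      ∑ (λ x → F C s x * krawtchouk n g (wt x))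
        ≡⟨ ∑-cong (λ x → cong (F C s x *_) (∑-krawtchouk g x)) ⟨
      ∑ (λ x → F C s x * ∑ (λ u → g ! wt u * sgn (u · x)))
        ≡⟨ ∑-cong (λ x → ∑-*ˡ (F C s x) (λ u → g ! wt u * sgn (u · x))) ⟨
      ∑ (λ x → ∑ (λ u → F C s x * (g ! wt u * sgn (u · x))))
        ≡⟨ ∑-swap (λ x u → F C s x * (g ! wt u * sgn (u · x))) ⟩
      ∑ (λ u → ∑ (λ x → F C s x * (g ! wt u * sgn (u · x))))
        ≡⟨ ∑-cong (λ u → ∑-cong (λ x → left-comm (F C s x) (g ! wt u) (sgn (u · x)))) ⟩
      ∑ (λ u → ∑ (λ x → g ! wt u * (F C s x * sgn (u · x))))
        ≡⟨ ∑-cong (λ u → ∑-*ˡ (g ! wt u) (λ x → F C s x * sgn (u · x))) ⟩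
      ∑ (λ u → g ! wt u * ∑ (λ x → F C s x * sgn (u · x)))
        ≡⟨ ∑-cong (λ u → cong (g ! wt u *_) (F-transform u)) ⟩
      ∑ (λ u → g ! wt u * - (card C * F C s u))
        ≡⟨ ∑-cong (λ u → pull (g ! wt u) (card C) (F C s u)) ⟩
      ∑ (λ u → - card C * (F C s u * g ! wt u))
        ≡⟨ ∑-*ˡ (- card C) (λ u → F C s u * g ! wt u) ⟩
      - card C * ∑ (λ u → F C s u * g ! wt u) ∎
      where
      pull : ∀ a b c → a * - (b * c) ≡ - b * (c * a)
      pull = solve-∀

    -- Since `𝟏` is in C the support is preserved, and `s · 𝟏` = `s · s` = 1 flips the sign.
    F-complement : ∀ x → F C s (x ⊕ 𝟏) ≡ - F C s x
    F-complement x = begin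
      𝟙[ C ] ((x ⊕ 𝟏) ⊕ s) * sgn (s · (x ⊕ 𝟏))
        ≡⟨ cong₂ (λ y b → 𝟙[ C ] y * sgn b) (⊕-swapʳ x 𝟏 s) (·-distribˡ-⊕ s x 𝟏) ⟩
      𝟙[ C ] ((x ⊕ s) ⊕ 𝟏) * sgn ((s · x) xor (s · 𝟏))
        ≡⟨ cong₂ (λ i b → i * sgn ((s · x) xor b)) (𝟙-⊕ (x ⊕ s) 𝟏∈C) (trans (·-𝟏 s) s·s≡1) ⟩
      𝟙[ C ] (x ⊕ s) * sgn ((s · x) xor true)
        ≡⟨ cong (𝟙[ C ] (x ⊕ s) *_) (sgn-xor (s · x) true) ⟩
      𝟙[ C ] (x ⊕ s) * (sgn (s · x) * -1ℤ)
        ≡⟨ negate (𝟙[ C ] (x ⊕ s)) (sgn (s · x)) ⟩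
      - F C s x ∎
      where
      negate : ∀ a b → a * (b * -1ℤ) ≡ - (a * b)
      negate = solve-∀

    -- Against `F C s` only the part of `h` that is odd under i ↦ n - i counts.
    F-fold : (h : ℕ → ℤ) → ∑ (λ x → F C s x * (h (wt x) - h (n ∸ wt x))) ≡ + 2 * ∑ (λ x → F C s x * h (wt x))
    F-fold h = begin
      ∑ (λ x → F C s x * (h (wt x) - h (n ∸ wt x)))
        ≡⟨ ∑-cong (λ x → distrib (F C s x) (h (wt x)) (h (n ∸ wt x))) ⟩
      ∑ (λ x → F C s x * h (wt x) + - F C s x * h (n ∸ wt x))
        ≡⟨ ∑-+ (λ x → F C s x * h (wt x)) (λ x → - F C s x * h (n ∸ wt x)) ⟩
      Σh + ∑ (λ x → - F C s x * h (n ∸ wt x))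
        ≡⟨ cong (_+_ Σh) (∑-cong (λ x → cong₂ (λ i w → i * h w) (F-complement x) (wt-⊕-𝟏 x))) ⟨
      Σh + ∑ (λ x → F C s (x ⊕ 𝟏) * h (wt (x ⊕ 𝟏)))
        ≡⟨ cong (_+_ Σh) (∑-translate 𝟏 (λ x → F C s x * h (wt x))) ⟨
      Σh + Σh
        ≡⟨ double Σh ⟩
      + 2 * Σh ∎
      where
      Σh = ∑ (λ x → F C s x * h (wt x))
      distrib : ∀ a b c → a * (b - c) ≡ a * b + - a * c
      distrib = solve-∀
      double : ∀ a → a + a ≡ + 2 * a
      double = solve-∀

  -- At the weights in the support of F, the odd parts of the transform of `g` and of A g agree.
  -- Pairing with F thus multiplies by A, but by -|C| according to `F-krawtchouk`; as A² ≠ |C|², the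
  -- pairing vanishes.
  F-orthogonal : ∀ g A → A * A ≢ + (2 ℕ.^ n) →
                 (∀ {i} → i ≤ n → i % 4 ≡ 1 → krawtchouk n g i - krawtchouk n g (n ∸ i) ≡ A * (g ! i - g ! (n ∸ i))) →
                 ∀ {s} → s ∈ Shadow C → wt s % 4 ≡ 1 → ∑ (λ x → F C s x * g ! wt x) ≡ 0ℤ
  F-orthogonal g A A²≢2ⁿ eigen {s} s∈S wt≡1 = distinct-eigenvalues A (card C) X
    (λ A²≡N² → A²≢2ⁿ (trans A²≡N² card²))
    (trans (sym Y≡A*X) (F-krawtchouk s s·s≡1 g))
    where
    s·s≡1 = wt≡1⇒self≡true s wt≡1
    f = F C s
    X = ∑ (λ x → f x * g ! wt x)
    Y = ∑ (λ x → f x * krawtchouk n g (wt x))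

    support : ∀ x → f x * (krawtchouk n g (wt x) - krawtchouk n g (n ∸ wt x)) ≡
                    A * (f x * (g ! wt x - g ! (n ∸ wt x)))
    support x with codeword? C (x ⊕ s)
    ... | no  _     = sym (ℤ.*-zeroʳ A)
    ... | yes x⊕s∈C = trans
      (cong ((1ℤ * sgn (s · x)) *_) (eigen (wt≤n x) (trans (shadow-wt-%4 s∈S x⊕s∈C) wt≡1)))
      (left-comm (1ℤ * sgn (s · x)) A (g ! wt x - g ! (n ∸ wt x)))

    Y≡A*X : Y ≡ A * X
    Y≡A*X = ℤ.*-cancelˡ-≡ (+ 2) Y (A * X) (begin
      + 2 * Y
        ≡⟨ F-fold s s·s≡1 (krawtchouk n g) ⟨
      ∑ (λ x → f x * (krawtchouk n g (wt x) - krawtchouk n g (n ∸ wt x)))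
        ≡⟨ ∑-cong support ⟩
      ∑ (λ x → A * (f x * (g ! wt x - g ! (n ∸ wt x))))
        ≡⟨ ∑-*ˡ A (λ x → f x * (g ! wt x - g ! (n ∸ wt x))) ⟩
      A * ∑ (λ x → f x * (g ! wt x - g ! (n ∸ wt x)))
        ≡⟨ cong (A *_) (F-fold s s·s≡1 (g !_)) ⟩
      A * (+ 2 * X)
        ≡⟨ left-comm A (+ 2) X ⟩
      + 2 * (A * X) ∎)

  -- Each term F(x) g(wt x) is congruent mod 2 to the contribution of `x` to B₉ + B₁₇, and these
  -- terms add up to 0 by `F-orthogonal`.
  B₉+B₁₇-even : ∀ g A → A * A ≢ + (2 ℕ.^ n) →
                (∀ {i} → i ≤ n → i % 4 ≡ 1 → krawtchouk n g i - krawtchouk n g (n ∸ i) ≡ A * (g ! i - g ! (n ∸ i))) →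
                (∀ b {i} → i ≤ n → 5 ≤ i → i % 4 ≡ 1 → + 2 ∣ sgn b * g ! i - (𝟙 (i ℕ.≟ 9) + 𝟙 (i ℕ.≟ 17))) →
                (∀ x → x ∈ Shadow C → 5 ≤ wt x) → + 2 ∣ + Wₛ[ C ] 9 + + Wₛ[ C ] 17
  B₉+B₁₇-even g A A²≢2ⁿ eigen g-mod-2 5≤wt =
    subst (+ 2 ∣_) (sym B₉+B₁₇≡) (∑B-even (anySubset? λ x → shadow? C x ×-dec (wt x % 4 ℕ.≟ 1)))
    where
    B : Word n → ℤ
    B x = 𝟙 (shadow? C x ×-dec (wt x ℕ.≟ 9)) + 𝟙 (shadow? C x ×-dec (wt x ℕ.≟ 17))

    B₉+B₁₇≡ : + Wₛ[ C ] 9 + + Wₛ[ C ] 17 ≡ ∑ B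
    B₉+B₁₇≡ = trans
      (cong₂ _+_ (length-filter-allWords (λ x → shadow? C x ×-dec (wt x ℕ.≟ 9)))
                 (length-filter-allWords (λ x → shadow? C x ×-dec (wt x ℕ.≟ 17))))
      (sym (∑-+ (λ x → 𝟙 (shadow? C x ×-dec (wt x ℕ.≟ 9))) (λ x → 𝟙 (shadow? C x ×-dec (wt x ℕ.≟ 17)))))

    ∑B-even : Dec (∃[ s ] s ∈ Shadow C × wt s % 4 ≡ 1) → + 2 ∣ ∑ B
    ∑B-even (no ∄s) = ∑-∣ (+ 2) λ x → divides 0ℤ (cong₂ _+_ (absent x 9 refl) (absent x 17 refl))
      where
      absent : ∀ x i → i % 4 ≡ 1 → 𝟙 (shadow? C x ×-dec (wt x ℕ.≟ i)) ≡ 0ℤ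
      absent x i i≡1 = cong (if_then 1ℤ else 0ℤ) (dec-false (shadow? C x ×-dec (wt x ℕ.≟ i))
        λ (x∈S , wt≡i) → ∄s (x , x∈S , trans (cong (_% 4) wt≡i) i≡1))
    ∑B-even (yes (s , s∈S , wt≡1)) = subst (+ 2 ∣_) ∑-≡ (∣m⇒∣-m (∑-∣ (+ 2) λ x → congruent x (shadow? C x) (codeword? C (x ⊕ s))))
      where
      f = F C s

      ∑-≡ : - ∑ (λ x → f x * g ! wt x - B x) ≡ ∑ B
      ∑-≡ = begin
        - ∑ (λ x → f x * g ! wt x - B x)                ≡⟨ cong -_ (∑-+ (λ x → f x * g ! wt x) (λ x → - B x)) ⟩
        - (∑ (λ x → f x * g ! wt x) + ∑ (λ x → - B x))  ≡⟨ cong -_ (cong₂ _+_ (F-orthogonal g A A²≢2ⁿ eigen s∈S wt≡1) (∑-neg B)) ⟩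
        - (0ℤ - ∑ B)                                    ≡⟨ cong -_ (ℤ.+-identityˡ (- ∑ B)) ⟩
        - - ∑ B                                         ≡⟨ ℤ.neg-involutive (∑ B) ⟩
        ∑ B                                             ∎

      -- Both decisions are arguments so that the indicators reduce by cases; the mixed cases
      -- contradict S = s ⊕ C.
      congruent : ∀ x (x∈S? : Dec (x ∈ Shadow C)) (x⊕s∈C? : Dec (x ⊕ s ∈ Codeword C)) →
                  + 2 ∣ 𝟙 x⊕s∈C? * sgn (s · x) * g ! wt x - (𝟙 (x∈S? ×-dec (wt x ℕ.≟ 9)) + 𝟙 (x∈S? ×-dec (wt x ℕ.≟ 17)))
      congruent x (no  _)   (no  _)     = divides 0ℤ refl
      congruent x (no  x∉S) (yes x⊕s∈C) = contradiction (codeword-⊕-shadow s∈S x⊕s∈C) x∉S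
      congruent x (yes x∈S) (no  x⊕s∉C) = contradiction (shadow-⊕-shadow s∈S x∈S) x⊕s∉C
      congruent x (yes x∈S) (yes x⊕s∈C) = subst (λ i → + 2 ∣ i * g ! wt x - (𝟙 (wt x ℕ.≟ 9) + 𝟙 (wt x ℕ.≟ 17)))
        (sym (ℤ.*-identityˡ (sgn (s · x))))
        (g-mod-2 (s · x) (wt≤n x) (5≤wt x x∈S) (trans (shadow-wt-%4 s∈S x⊕s∈C) wt≡1))

-- The invariant of length 106

-- The nonzero entries are those of P(i) = C((53 - i)/4 + 8, 17) at i ≡ 1 (mod 4)
-- with i ≤ 17. The transform of γ is 2⁵¹ P, which is odd about 53 and vanishes
-- at 21, 25, …, 85.
γ : List ℤ
γ = 0ℤ ∷ + 5985 ∷ 0ℤ ∷ 0ℤ ∷ 0ℤ ∷ + 1140 ∷ 0ℤ ∷ 0ℤ ∷ 0ℤ ∷ + 171 ∷ 0ℤ ∷ 0ℤ ∷ 0ℤ ∷ + 18 ∷ 0ℤ ∷ 0ℤ ∷ 0ℤ ∷ 1ℤ ∷ []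

-- As P is odd about 53, the left side is 2 · 2⁵¹ P(i), and the difference on the right restores
-- P(i) from its part with i ≤ 17. Verified by evaluation at every weight.
krawtchouk-γ : ∀ {i} → i < 107 → i % 4 ≡ 1 →
               krawtchouk 106 γ i - krawtchouk 106 γ (106 ∸ i) ≡ + (2 ℕ.^ 52) * (γ ! i - γ ! (106 ∸ i))
krawtchouk-γ = from-yes (ℕ.allUpTo? (λ i → (i % 4 ℕ.≟ 1) →-dec
  (krawtchouk 106 γ i - krawtchouk 106 γ (106 ∸ i) ℤ.≟ + (2 ℕ.^ 52) * (γ ! i - γ ! (106 ∸ i)))) 107)

-- Among the entries from weight 5 on, 171 and 1 at weights 9 and 17 are odd, 1140 and 18 at weights
-- 5 and 13 are even.
γ-mod-2 : ∀ b {i} → i < 107 → 5 ≤ i → i % 4 ≡ 1 → + 2 ∣ sgn b * γ ! i - (𝟙 (i ℕ.≟ 9) + 𝟙 (i ℕ.≟ 17))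
γ-mod-2 false = from-yes (ℕ.allUpTo? (λ i → (5 ℕ.≤? i) →-dec ((i % 4 ℕ.≟ 1) →-dec
  (+ 2 ∣? 1ℤ * γ ! i - (𝟙 (i ℕ.≟ 9) + 𝟙 (i ℕ.≟ 17))))) 107)
γ-mod-2 true  = from-yes (ℕ.allUpTo? (λ i → (5 ℕ.≤? i) →-dec ((i % 4 ℕ.≟ 1) →-dec
  (+ 2 ∣? -1ℤ * γ ! i - (𝟙 (i ℕ.≟ 9) + 𝟙 (i ℕ.≟ 17))))) 107)

-- Separates the eigenvalue 2⁵² from -|C|, whose square is 2¹⁰⁶.
2^104≢2^106 : + (2 ℕ.^ 52) * + (2 ℕ.^ 52) ≢ + (2 ℕ.^ 106)
2^104≢2^106 = from-no (+ (2 ℕ.^ 52) * + (2 ℕ.^ 52) ℤ.≟ + (2 ℕ.^ 106))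

proposition3 : (C : Code 106) → SelfDual C → SinglyEven C → Is[ 106 , 53 , 18 ] C →
    (∀ x → x ∈ Shadow C → 5 ≤ wt x) →
    (a b c d : ℤ) →
    W[ C ] ≈
    (+ 1) y^ 0
    ∷ (+ 35245 + + 2 * d) y^ 18
    ∷ (+ 416262 + + 128 * c - + 2 * d) y^ 20
    ∷ (+ 6586310 + + 8192 * b - + 896 * c - + 34 * d) y^ 22
    ∷ (+ 86626645 + + 524288 * a - + 106496 * b + + 1024 * c + + 34 * d) y^ 24
    ∷ [] +higherThan 24 →
    Wₛ[ C ] ≈
    a y^ 5
    ∷ (- (+ 24) * a - b) y^ 9
    ∷ (+ 276 * a + + 22 * b + c) y^ 13
    ∷ (- (+ 2024) * a - + 231 * b - + 20 * c - d) y^ 17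
    ∷ [] +higherThan 17 →
    + 2 ∣ d
proposition3 C C≐C^⊥ _ _ 5≤wt a b c d _ W-shadow = ∣m+n∣m⇒∣n
  -- In B₉ + B₁₇ + d the `d` cancels, leaving -2048a - 232b - 20c; the witness is half of this.
  (subst (+ 2 ∣_) B₉+B₁₇+d (divides (- (+ 1024) * a - + 116 * b - + 10 * c) (regroup a b c d)))
  (B₉+B₁₇-even C C≐C^⊥ γ (+ (2 ℕ.^ 52)) 2^104≢2^106
    -- The finite checks range over i < 107, that is, i ≤ 106.
    (λ i≤106 → krawtchouk-γ (s≤s i≤106)) (λ b i≤106 → γ-mod-2 b (s≤s i≤106)) 5≤wt)
  where
  B₉  = - (+ 24) * a - b
  B₁₇ = - (+ 2024) * a - + 231 * b - + 20 * c - d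

  B₉+B₁₇+d : B₉ + B₁₇ + d ≡ + Wₛ[ C ] 9 + + Wₛ[ C ] 17 + d
  B₉+B₁₇+d = sym (cong₂ (λ i j → i + j + d)
    -- `coefficient` adds a final `0ℤ` after the matching term.
    (trans (W-shadow 9 (from-yes (9 ℕ.≤? 17))) (ℤ.+-identityʳ B₉))
    (trans (W-shadow 17 ℕ.≤-refl) (ℤ.+-identityʳ B₁₇)))

  regroup : ∀ a b c d → - (+ 24) * a - b + (- (+ 2024) * a - + 231 * b - + 20 * c - d) + d ≡
                        (- (+ 1024) * a - + 116 * b - + 10 * c) * + 2
  regroup = solve-∀
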